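{- For every fixed integer $r\geq 1$ and every $\epsilon>0$, for all sufficiently large $k$, $$AW(k;r)\geq \frac{k^{2r-1-\epsilon}}{2^{r-1}(40r)^{r^2-1}}.$$
   Context: A sequence of positive integers $w_1<\dots<w_n$ is an ascending wave if $w_{i+1}-w_i \geq w_i-w_{i-1}$ for $2\le i\le n-1$. For positive integers $k,r$, $AW(k;r)$ denotes the least positive integer $N$ such that every $r$-coloring of $\{1,\dots,N\}$ contains a $k$-term monochromatic ascending wave. -}

module Defs where

open import Data.Empty using (⊥-elim)
open import Data.Fin.Base as Fin using (Fin; zero; suc; toℕ; finToFun; funToFin)
open import Data.Fin.Properties as Finₚ using (all?; any?; finToFun-funToFin; toℕ-fromℕ<)
open import Data.Integer.Base using (+_; -[1+_])
open import Data.List.Base using (List; []; _∷_; allFin)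
open import Data.List.Membership.Propositional using (_∈_)
open import Data.List.Membership.Propositional.Properties using (∈-allFin)
open import Data.List.Relation.Unary.Any using (here; there)
open import Data.Nat.Base using (ℕ; zero; suc; _+_; _*_; _∸_; _^_; _≤_; _<_; z≤n; s≤s; z<s)
open import Data.Nat.DivMod using (_mod_; m<n⇒m%n≡m; m%n<n)
import Data.Nat.Properties as ℕₚ
open import Data.Product.Base using (∃; _×_; _,_; proj₁; proj₂)
open import Data.Rational.Base as ℚ using (ℚ; mkℚ)
import Data.Rational.Properties as ℚₚ
open import Algebra.Properties.AbelianGroup ℚₚ.+-0-abelianGroup using (⁻¹-anti-homo‿-)
open import Data.Sum.Base using (_⊎_; inj₁; inj₂)
import Data.Sum.Base as Sum
open import Function.Base using (_∘_)
open import Relation.Binary.PropositionalEquality using (_≡_; refl; sym; trans; cong; subst; subst₂; _≗_)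
open import Relation.Nullary.Decidable using (Dec; yes; no; map′; _×-dec_; _→-dec_)

-- Since w is strictly increasing, the truncated subtractions in `convex`
-- are the true differences of consecutive terms.
record IsAscendingWave {n : ℕ} (w : Fin n → ℕ) : Set where
  field
    positive   : ∀ i → 0 < w i
    increasing : ∀ i j → toℕ j ≡ suc (toℕ i) → w i < w j
    convex     : ∀ h i j → toℕ i ≡ suc (toℕ h) → toℕ j ≡ suc (toℕ i) →
                 w i ∸ w h ≤ w j ∸ w i

-- An index x : Fin N stands for the integer suc (toℕ x) of {1,…,N}.
Colouring : ℕ → ℕ → Set
Colouring N r = Fin N → Fin r

HasMonochromaticWave : ∀ {N r} → ℕ → Colouring N r → Set
HasMonochromaticWave {N} {r} k χ =
  ∃ λ (p : Fin k → Fin N) →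
    IsAscendingWave (λ i → suc (toℕ (p i))) × ∃ λ (c : Fin r) → ∀ i → χ (p i) ≡ c

Forces : (k r N : ℕ) → Set
Forces k r N = (χ : Colouring N r) → HasMonochromaticWave k χ

record IsAW (k r N : ℕ) : Set where
  field
    positive : 0 < N
    forces   : Forces k r N
    least    : ∀ M → 0 < M → Forces k r M → N ≤ M

private

  -- Chain P n w d: a wave w = w₀ < w₁ < … < wₙ inside P with w₁ - w₀ ≥ d.
  data Chain (P : ℕ → Set) : (n w d : ℕ) → Set where
    end  : ∀ {w d} → P w → Chain P 0 w d
    step : ∀ {n w d} e → 0 < e → d ≤ e → P w →
           Chain P n (w + e) e → Chain P (suc n) w d

  mapChain : ∀ {P Q : ℕ → Set} → (∀ {x} → P x → Q x) →
             ∀ {n w d} → Chain P n w d → Chain Q n w d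
  mapChain f (end p)            = end (f p)
  mapChain f (step e e>0 d≤e p c) = step e e>0 d≤e (f p) (mapChain f c)

  module _ {P : ℕ → Set} where

    at : ∀ {n w d} → Chain P n w d → Fin (suc n) → ℕ
    at {w = w} _                zero    = w
    at         (step _ _ _ _ c) (suc i) = at c i

    at-P : ∀ {n w d} (c : Chain P n w d) i → P (at c i)
    at-P (end p)          zero    = p
    at-P (step _ _ _ p _) zero    = p
    at-P (step _ _ _ _ c) (suc i) = at-P c i

    at-inc : ∀ {n w d} (c : Chain P n w d) i j → toℕ j ≡ suc (toℕ i) → at c i < at c j
    at-inc (end _) zero zero ()
    at-inc {w = w} (step e e>0 _ _ c) zero (suc zero) _ = ℕₚ.m<m+n w e>0
    at-inc (step _ _ _ _ _) zero (suc (suc _)) ()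
    at-inc (step _ _ _ _ c) (suc i) (suc j) eq = at-inc c i j (ℕₚ.suc-injective eq)

    at-convex : ∀ {n w d} (c : Chain P n w d) h i j →
                toℕ i ≡ suc (toℕ h) → toℕ j ≡ suc (toℕ i) →
                at c i ∸ at c h ≤ at c j ∸ at c i
    at-convex (end _) zero zero _ () _
    at-convex {w = w} (step e _ _ _ (step e′ _ e≤e′ _ _)) zero (suc zero) (suc (suc zero)) _ _ =
      subst₂ _≤_ (sym (ℕₚ.m+n∸m≡n w e)) (sym (ℕₚ.m+n∸m≡n (w + e) e′)) e≤e′
    at-convex (step _ _ _ _ c) zero (suc zero) (suc zero) _ ()
    at-convex (step _ _ _ _ (step _ _ _ _ _)) zero (suc zero) (suc (suc (suc _))) _ ()
    at-convex (step _ _ _ _ c) zero (suc (suc _)) _ () _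
    at-convex (step _ _ _ _ c) (suc h) (suc i) (suc j) p q =
      at-convex c h i j (ℕₚ.suc-injective p) (ℕₚ.suc-injective q)

  room : (M j D : ℕ) → ℕ
  room M zero    D = 1
  room M (suc j) D = (suc D + M) + room M j (suc D + M)

  MonoChain : ∀ {r} (χ : ℕ → Fin r) (n hi : ℕ) → Set
  MonoChain χ n hi = ∃ λ c → ∃ λ w → Chain (λ x → χ x ≡ c × x < hi) n w 0

  Unavoidable : ∀ {r} (n : ℕ) (cs : List (Fin r)) (M : ℕ) → Set
  Unavoidable {r} n cs M = ∀ (χ : ℕ → Fin r) a →
    (∀ x → a ≤ x → x < a + M → χ x ∈ cs) → MonoChain χ n (a + M)

  -- Any window of length M either contains the colour c, which extends the
  -- current wave, or uses only the colours cs, which force a wave in it.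
  module Extend {r n M : ℕ} {c : Fin r} {cs : List (Fin r)} (un : Unavoidable n cs M)
                (χ : ℕ → Fin r) (a hi : ℕ)
                (inside : ∀ x → a ≤ x → x < hi → χ x ∈ c ∷ cs) where

    window : ∀ b → a ≤ b → b + M ≤ hi →
             MonoChain χ n hi ⊎ ∃ λ x → x < M × χ (b + x) ≡ c
    window b a≤b b+M≤hi with ℕₚ.anyUpTo? (λ x → χ (b + x) Finₚ.≟ c) M
    ... | yes found = inj₂ found
    ... | no none   = inj₁ (widen (un χ b others))
      where
      widen : MonoChain χ n (b + M) → MonoChain χ n hi
      widen (c′ , w , ch) = c′ , w , mapChain (λ (q , lt) → q , ℕₚ.<-≤-trans lt b+M≤hi) ch

      others : ∀ x → b ≤ x → x < b + M → χ x ∈ cs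
      others x b≤x x<b+M with inside x (ℕₚ.≤-trans a≤b b≤x) (ℕₚ.<-≤-trans x<b+M b+M≤hi)
      ... | there m = m
      ... | here eq = ⊥-elim (none (x ∸ b
                    , ℕₚ.+-cancelˡ-< b _ _ (subst (_< b + M) (sym (ℕₚ.m+[n∸m]≡n b≤x)) x<b+M)
                    , trans (cong χ (ℕₚ.m+[n∸m]≡n b≤x)) eq))

    extend : ∀ j w d D → a ≤ w → d ≤ D → w + room M j D ≤ hi → χ w ≡ c →
             MonoChain χ n hi ⊎ Chain (λ x → χ x ≡ c × x < hi) j w d
    extend zero w d D a≤w d≤D fits eq =
      inj₂ (end (eq , ℕₚ.≤-trans (ℕₚ.≤-reflexive (ℕₚ.+-comm 1 w)) fits))
    extend (suc j) w d D a≤w d≤D fits eq =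
      go (window (w + suc d) (ℕₚ.≤-trans a≤w (ℕₚ.m≤m+n w _))
           (ℕₚ.≤-trans (ℕₚ.≤-reflexive (ℕₚ.+-assoc w (suc d) M))
             (ℕₚ.≤-trans (ℕₚ.+-monoʳ-≤ w (ℕₚ.≤-trans (ℕₚ.+-monoˡ-≤ M (s≤s d≤D)) (ℕₚ.m≤m+n _ _)))
               fits)))
      where
      go : MonoChain χ n hi ⊎ (∃ λ x → x < M × χ (w + suc d + x) ≡ c) →
           MonoChain χ n hi ⊎ Chain (λ x → χ x ≡ c × x < hi) (suc j) w d
      go (inj₁ done) = inj₁ done
      go (inj₂ (x , x<M , eq′)) =
        Sum.map₂ (step e z<s (ℕₚ.≤-trans (ℕₚ.n≤1+n d) (ℕₚ.m≤m+n (suc d) x))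
                    (eq , ℕₚ.<-≤-trans (ℕₚ.m<m+n w z<s) fits))
          (extend j (w + e) e (suc D + M) (ℕₚ.≤-trans a≤w (ℕₚ.m≤m+n w e)) e≤
            (ℕₚ.≤-trans (ℕₚ.≤-reflexive (ℕₚ.+-assoc w e _))
              (ℕₚ.≤-trans (ℕₚ.+-monoʳ-≤ w (ℕₚ.+-monoˡ-≤ _ e≤)) fits))
            (trans (cong χ (sym (ℕₚ.+-assoc w (suc d) x))) eq′))
        where
        e : ℕ
        e = suc d + x

        e≤ : e ≤ suc D + M
        e≤ = ℕₚ.+-mono-≤ (s≤s d≤D) (ℕₚ.<⇒≤ x<M)

  unavoidable : ∀ {r} n (cs : List (Fin r)) → ∃ (Unavoidable n cs)
  unavoidable n [] = 1 , λ χ a inside → absurd (inside a ℕₚ.≤-refl (ℕₚ.m<m+n a z<s))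
    where
    absurd : ∀ {A : Set} {r} {c : Fin r} → c ∈ [] → A
    absurd ()
  unavoidable {r} n (c ∷ cs) with unavoidable n cs
  ... | M , un = M + room M n 0 , λ χ a inside →
    let open Extend {c = c} un χ a (a + (M + room M n 0)) inside
    in finish χ a inside (window a ℕₚ.≤-refl (ℕₚ.+-monoʳ-≤ a (ℕₚ.m≤m+n M _)))
    where
    finish : ∀ χ a → (∀ x → a ≤ x → x < a + (M + room M n 0) → χ x ∈ c ∷ cs) →
             MonoChain χ n (a + (M + room M n 0)) ⊎ (∃ λ x → x < M × χ (a + x) ≡ c) →
             MonoChain χ n (a + (M + room M n 0))
    finish χ a inside (inj₁ done) = done
    finish χ a inside (inj₂ (x , x<M , eq))
      with Extend.extend {c = c} un χ a (a + (M + room M n 0)) inside n (a + x) 0 0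
             (ℕₚ.m≤m+n a x) z≤n
             (ℕₚ.≤-trans (ℕₚ.≤-reflexive (ℕₚ.+-assoc a x _))
               (ℕₚ.+-monoʳ-≤ a (ℕₚ.+-monoˡ-≤ _ (ℕₚ.<⇒≤ x<M))))
             eq
    ... | inj₁ done = done
    ... | inj₂ ch   = c , a + x , ch

  toℕ-mod : ∀ {x n} → x < suc n → toℕ (x mod suc n) ≡ x
  toℕ-mod {x} {n} x<n = trans (toℕ-fromℕ< (m%n<n x (suc n))) (m<n⇒m%n≡m x<n)

  resp-wave : ∀ {n} {v w : Fin n → ℕ} → v ≗ w → IsAscendingWave v → IsAscendingWave w
  resp-wave {v = v} {w} v≗w V = record
    { positive   = λ i → subst (0 <_) (v≗w i) (V.positive i)
    ; increasing = λ i j eq → subst₂ _<_ (v≗w i) (v≗w j) (V.increasing i j eq)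
    ; convex     = λ h i j p q → subst₂ _≤_ (diff h i) (diff i j) (V.convex h i j p q)
    }
    where
    module V = IsAscendingWave V

    diff : ∀ h i → v i ∸ v h ≡ w i ∸ w h
    diff h i rewrite v≗w h | v≗w i = refl

  forces-some : ∀ k r → ∃ λ m → Forces k r (suc m)
  forces-some zero r = 0 , λ χ → (λ ()) ,
    record { positive = λ () ; increasing = λ () ; convex = λ () } , χ zero , λ ()
  forces-some (suc n) r with unavoidable n (allFin r)
  ... | M , un = M , λ χ → build χ (un (λ x → χ (x mod suc M)) 0 (λ _ _ _ → ∈-allFin _))
    where
    build : ∀ χ → MonoChain (λ x → χ (x mod suc M)) n M → HasMonochromaticWave (suc n) χ
    build χ (c , w , ch) = (λ i → at ch i mod suc M)
      , resp-wave (λ i → cong suc (sym (toℕ-mod (ℕₚ.m<n⇒m<1+n (proj₂ (at-P ch i))))))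
          (record { positive   = λ _ → z<s
                  ; increasing = λ i j eq → s≤s (at-inc ch i j eq)
                  ; convex     = at-convex ch })
      , c , λ i → proj₁ (at-P ch i)

  wave? : ∀ {n} (w : Fin n → ℕ) → Dec (IsAscendingWave w)
  wave? w = map′
    (λ (p , i , c) → record { positive = p ; increasing = i ; convex = c })
    (λ W → let open IsAscendingWave W in positive , increasing , convex)
    (all? (λ i → 0 ℕₚ.<? w i)
      ×-dec all? (λ i → all? λ j → (toℕ j ℕₚ.≟ suc (toℕ i)) →-dec (w i ℕₚ.<? w j))
      ×-dec all? (λ h → all? λ i → all? λ j →
              (toℕ i ℕₚ.≟ suc (toℕ h)) →-dec ((toℕ j ℕₚ.≟ suc (toℕ i)) →-dec
                (w i ∸ w h ℕₚ.≤? w j ∸ w i))))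

  module _ {m n : ℕ} {Q : (Fin m → Fin n) → Set}
           (resp : ∀ {f g} → f ≗ g → Q f → Q g) (Q? : ∀ f → Dec (Q f)) where

    anyFun? : Dec (∃ Q)
    anyFun? = map′ (λ (i , q) → finToFun i , q)
                   (λ (f , q) → funToFin f , resp (sym ∘ finToFun-funToFin f) q)
                   (any? (λ i → Q? (finToFun i)))

    allFun? : Dec (∀ f → Q f)
    allFun? = map′ (λ q f → resp (finToFun-funToFin f) (q (funToFin f)))
                   (λ q i → q (finToFun i))
                   (all? (λ i → Q? (finToFun i)))

  forces? : ∀ k r N → Dec (Forces k r N)
  forces? k r N = allFun?
    (λ χ≗χ′ (p , W , c , eq) → p , W , c , λ i → trans (sym (χ≗χ′ (p i))) (eq i))
    (λ χ → anyFun?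
      (λ p≗q (W , c , eq) → resp-wave (cong (suc ∘ toℕ) ∘ p≗q) W
                          , c , λ i → trans (cong χ (sym (p≗q i))) (eq i))
      (λ p → wave? _ ×-dec any? λ c → all? λ i → χ (p i) Finₚ.≟ c))

  search : ∀ k r n N → 0 < N → (∀ M → 0 < M → Forces k r M → N ≤ M) →
           Forces k r (n + N) → ∃ (IsAW k r)
  search k r n N N>0 lb F with forces? k r N
  search k r n       N N>0 lb F | yes f = N , record { positive = N>0 ; forces = f ; least = lb }
  search k r zero    N N>0 lb F | no ¬f = ⊥-elim (¬f F)
  search k r (suc n) N N>0 lb F | no ¬f =
    search k r n (suc N) z<s
      (λ M M>0 f → ℕₚ.≤∧≢⇒< (lb M M>0 f) (λ eq → ¬f (subst (Forces k r) (sym eq) f)))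
      (subst (Forces k r) (sym (ℕₚ.+-suc n N)) F)

abstract
  AW-exists : ∀ k r → ∃ (IsAW k r)
  AW-exists k r with forces-some k r
  ... | m , F = search k r m 1 z<s (λ _ M>0 _ → M>0) (subst (Forces k r) (ℕₚ.+-comm 1 m) F)

AW : (k r : ℕ) → ℕ
AW k r = proj₁ (AW-exists k r)

AW-isAW : ∀ k r → IsAW k r (AW k r)
AW-isAW k r = proj₂ (AW-exists k r)

record ℝ : Set₁ where
  field
    Lower Upper     : ℚ → Set
    lower-inhabited : ∃ Lower
    upper-inhabited : ∃ Upper
    lower-closed    : ∀ {p q} → p ℚ.< q → Lower q → Lower p
    upper-closed    : ∀ {p q} → p ℚ.< q → Upper p → Upper q
    lower-open      : ∀ {p} → Lower p → ∃ λ q → p ℚ.< q × Lower q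
    upper-open      : ∀ {q} → Upper q → ∃ λ p → p ℚ.< q × Upper p
    disjoint        : ∀ {p q} → Lower p → Upper q → p ℚ.< q
    located         : ∀ {p q} → p ℚ.< q → Lower p ⊎ Upper q

open ℝ public

infix 4 _<ℝ_ _ℝ<_

_<ℝ_ : ℚ → ℝ → Set
q <ℝ x = Lower x q

_ℝ<_ : ℝ → ℚ → Set
x ℝ< q = Upper x q

private
  reflect-< : ∀ c {p q} → p ℚ.< q → c ℚ.- q ℚ.< c ℚ.- p
  reflect-< c p<q = ℚₚ.+-monoʳ-< c (ℚₚ.neg-antimono-< p<q)

  reflect-reflect : ∀ c q → c ℚ.- (c ℚ.- q) ≡ q
  reflect-reflect c q = trans (cong (c ℚ.+_) (⁻¹-anti-homo‿- c q))
    (trans (ℚₚ.+-comm c (q ℚ.- c)) (trans (ℚₚ.+-assoc q (ℚ.- c) c)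
      (trans (cong (q ℚ.+_) (ℚₚ.+-inverseˡ c)) (ℚₚ.+-identityʳ q))))

infixl 6 _-ℝ_

_-ℝ_ : ℚ → ℝ → ℝ
c -ℝ x = record
  { Lower           = λ q → x ℝ< c ℚ.- q
  ; Upper           = λ q → c ℚ.- q <ℝ x
  ; lower-inhabited = let (q , u) = upper-inhabited x in c ℚ.- q , subst (Upper x) (back q) u
  ; upper-inhabited = let (q , l) = lower-inhabited x in c ℚ.- q , subst (Lower x) (back q) l
  ; lower-closed    = λ p<q → upper-closed x (reflect-< c p<q)
  ; upper-closed    = λ p<q → lower-closed x (reflect-< c p<q)
  ; lower-open      = λ {p} u → let (q , q<c-p , u′) = upper-open x u in
      c ℚ.- q , subst (ℚ._< c ℚ.- q) (reflect-reflect c p) (reflect-< c q<c-p)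
              , subst (Upper x) (back q) u′
  ; upper-open      = λ {q} l → let (p , c-q<p , l′) = lower-open x l in
      c ℚ.- p , subst (c ℚ.- p ℚ.<_) (reflect-reflect c q) (reflect-< c c-q<p)
              , subst (Lower x) (back p) l′
  ; disjoint        = λ {p} {q} u l → subst₂ ℚ._<_ (reflect-reflect c p) (reflect-reflect c q)
      (reflect-< c (disjoint x l u))
  ; located         = λ p<q → Sum.swap (located x (reflect-< c p<q))
  }
  where
  back : ∀ q → q ≡ c ℚ.- (c ℚ.- q)
  back q = sym (reflect-reflect c q)

infix 4 _^ℚ_≤_ _^ℝ_≤_

-- k ^ (n / d) ≤ y, raised to the d-th power and cleared of negative exponents.
_^ℚ_≤_ : ℕ → ℚ → ℕ → Set
k ^ℚ q@(mkℚ (+ n)    _ _) ≤ y = k ^ n ≤ y ^ ℚ.denominatorℕ q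
k ^ℚ q@(mkℚ -[1+ n ] _ _) ≤ y = 1 ≤ y ^ ℚ.denominatorℕ q * k ^ suc n

-- For real x and k ≥ 1, k ^ x is the supremum of k ^ q over the rationals q < x.
_^ℝ_≤_ : ℕ → ℝ → ℕ → Set
k ^ℝ x ≤ y = ∀ q → q <ℝ x → k ^ℚ q ≤ y

{-# OPTIONS --safe #-}

-- Suppose χ colours [0,B) with r colours and has no monochromatic u-term wave.
-- Cut [0,N) into blocks of length B and let block j repeat χ in the r colours
-- other than τ j. Here τ is typical: for every colour c and every progression of
-- difference at least 2B, some i < s has τ b = τ (b + 1) = c, where b is the block
-- of the i-th term. Only N² progressions matter, so by counting such a τ exists
-- with s of order log N.
-- A wave of colour c avoids the blocks j with τ j = c. While its differences are
-- below B it visits every block on its way, with fewer than u terms in each, so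
-- this phase ends within 2su terms. Afterwards its difference grows by at least
-- B/2s over any 2s steps: otherwise the wave would stay within distance B of a
-- progression, so that each term lies in the block b of the corresponding term of
-- the progression or in b + 1, and it would meet a block with τ j = c. Hence after
-- 2su further steps the difference is at least uB/2s, and the next 2su steps lead
-- beyond u²B. Each new colour thus multiplies N by k² up to powers of log k, which
-- are absorbed by k^ε.
module Submission where

open import Defs
open import Data.Bool.Base using (true; false; if_then_else_; _∧_)
open import Data.Fin.Base using (Fin; zero; suc; toℕ; fromℕ<; punchIn; combine; remQuot)
open import Data.Fin.Properties using (_≟_; any?; punchIn-injective; punchInᵢ≢i; remQuot-combine; toℕ<n; toℕ-fromℕ<)
open import Data.List.Base using (List; []; _∷_; length)
open import Data.Nat.Base renaming (_/_ to _÷_)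
open import Data.Nat.Coprimality using (Coprime)
open import Data.Nat.DivMod hiding (_/_; _%_)
open import Data.Nat.Divisibility using (n∣m*n)
open import Data.Nat.Properties hiding (_≟_)
open import Data.Nat.Tactic.RingSolver using (solve-∀)
open import Data.Product.Base using (∃; ∃-syntax; _×_; _,_; proj₁; proj₂)
open import Data.Sum.Base using (_⊎_; inj₁; inj₂)
open import Relation.Binary.PropositionalEquality
open import Relation.Nullary using (¬_; Dec; yes; no; does; contradiction)
open import Algebra.Properties.CommutativeMonoid.Sum +-0-commutativeMonoid using (sum; sum-cong-≗; ∑-comm)
open import Algebra.Properties.Semiring.Sum +-*-semiring using (*-distribʳ-sum)

-- Finite sums and extended sequences

infixr 5 _◂_

_◂_ : ∀ {A : Set} → A → (ℕ → A) → ℕ → A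
(a ◂ τ) zero    = a
(a ◂ τ) (suc n) = τ n

sum-const : ∀ n x → sum {n} (λ _ → x) ≡ n * x
sum-const zero    x = refl
sum-const (suc n) x = cong (x +_) (sum-const n x)

sum-≥ : ∀ {n} (f : Fin n → ℕ) {x} → (∀ i → x ≤ f i) → n * x ≤ sum f
sum-≥ {zero}  f h = z≤n
sum-≥ {suc n} f h = +-mono-≤ (h zero) (sum-≥ (λ i → f (suc i)) (λ i → h (suc i)))

term≤sum : ∀ {n} (f : Fin n → ℕ) i → f i ≤ sum f
term≤sum f zero    = m≤m+n _ _
term≤sum f (suc i) = ≤-trans (term≤sum (λ i → f (suc i)) i) (m≤n+m _ (f zero))

sum≡0⇒term≡0 : ∀ {n} (f : Fin n → ℕ) → sum f ≡ 0 → ∀ i → f i ≡ 0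
sum≡0⇒term≡0 f eq i = n≤0⇒n≡0 (≤-trans (term≤sum f i) (≤-reflexive eq))

sum-pick : ∀ {n} (c : Fin (suc n)) x y →
           sum (λ a → if does (a ≟ c) then x else y) ≡ x + n * y
sum-pick {n}     zero    x y = cong (x +_) (sum-const n y)
sum-pick {suc n} (suc c) x y = trans (cong (y +_) (sum-pick c x y)) (swap y x (n * y))
  where
  swap : ∀ a b c → a + (b + c) ≡ b + (a + c)
  swap = solve-∀

sum-<⇒∃ : ∀ {n} (f : Fin n → ℕ) x → sum f < n * x → ∃ λ i → f i < x
sum-<⇒∃ f x lt with any? (λ i → f i <? x)
... | yes found = found
... | no none   = contradiction lt (≤⇒≯ (sum-≥ f (λ i → ≮⇒≥ (λ fi<x → none (i , fi<x)))))

-- Counting assignments: existence of a typical `τ`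

module _ {r : ℕ} where

  private
    R = suc r

  -- The sum of f over all assignments of R values to the first m arguments.
  total : ℕ → ((ℕ → Fin R) → ℕ) → ℕ
  total zero    f = f (λ _ → zero)
  total (suc m) f = sum (λ a → total m (λ τ → f (a ◂ τ)))

  total-const : ∀ m x → total m (λ _ → x) ≡ R ^ m * x
  total-const zero    x = sym (+-identityʳ x)
  total-const (suc m) x = begin
    sum {R} (λ _ → total m (λ _ → x)) ≡⟨ sum-const R _ ⟩
    R * total m (λ _ → x)             ≡⟨ cong (R *_) (total-const m x) ⟩
    R * (R ^ m * x)                   ≡⟨ *-assoc R (R ^ m) x ⟨
    R ^ suc m * x                     ∎
    where open ≡-Reasoning

  total-sum : ∀ m {n} (F : Fin n → (ℕ → Fin R) → ℕ) →
              total m (λ τ → sum (λ j → F j τ)) ≡ sum (λ j → total m (F j))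
  total-sum zero    F = refl
  total-sum (suc m) F = trans
    (sum-cong-≗ (λ a → total-sum m (λ j τ → F j (a ◂ τ))))
    (∑-comm (λ a j → total m (λ τ → F j (a ◂ τ))))

  total-if : ∀ m b f → total m (λ τ → if b then 0 else f τ) ≡ (if b then 0 else total m f)
  total-if m true  f = trans (total-const m 0) (*-zeroʳ (R ^ m))
  total-if m false f = refl

  -- First moment method: if the mean of `f` is below 1, some choice of the first value keeps it
  -- below 1; fixing the values one by one leaves a natural number below 1.
  total-<⇒∃zero : ∀ m f → total m f < R ^ m → ∃ λ τ → f τ ≡ 0
  total-<⇒∃zero zero    f lt = _ , n<1⇒n≡0 lt
  total-<⇒∃zero (suc m) f lt with sum-<⇒∃ _ (R ^ m) lt
  ... | a , lt′ with total-<⇒∃zero m (λ τ → f (a ◂ τ)) lt′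
  ... | τ , eq = a ◂ τ , eq

  -- A list of gaps encodes disjoint pairs {p, p+1}; `misses` is 1 if no
  -- such pair has both values equal to c, and 0 otherwise.
  misses : List ℕ → Fin R → (ℕ → Fin R) → ℕ
  misses []       c τ = 1
  misses (g ∷ gs) c τ =
    if does (τ g ≟ c) ∧ does (τ (suc g) ≟ c) then 0 else misses gs c (λ n → τ (2 + g + n))

  span : List ℕ → ℕ
  span []       = 0
  span (g ∷ gs) = 2 + g + span gs

  sum-pair : ∀ (c : Fin R) x →
    sum (λ a → sum (λ b → if does (a ≟ c) ∧ does (b ≟ c) then 0 else x)) ≡ (R * R ∸ 1) * x
  sum-pair c x = begin
    sum (λ a → sum (λ b → if does (a ≟ c) ∧ does (b ≟ c) then 0 else x))
      ≡⟨ sum-cong-≗ (λ a → inner (does (a ≟ c))) ⟩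
    sum (λ a → if does (a ≟ c) then r * x else R * x)
      ≡⟨ sum-pick c (r * x) (R * x) ⟩
    r * x + r * (R * x)
      ≡⟨ factor r x ⟩
    (r + r * R) * x ∎
    where
    open ≡-Reasoning

    inner : ∀ b → sum (λ b′ → if b ∧ does (b′ ≟ c) then 0 else x) ≡ (if b then r * x else R * x)
    inner true  = sum-pick c 0 x
    inner false = sum-const R x

    factor : ∀ r x → r * x + r * (suc r * x) ≡ (r + r * suc r) * x
    factor = solve-∀

  -- Disjoint pairs are independent, and each fails to be (c, c) with probability 1 - 1/R². This is
  -- the resulting product with denominators cleared.
  total-misses : ∀ gs m c → total (span gs + m) (misses gs c) * (R * R) ^ length gs
                          ≡ R ^ (span gs + m) * (R * R ∸ 1) ^ length gs
  total-misses [] m c = cong (_* 1) (trans (total-const m 1) (*-identityʳ (R ^ m)))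
  -- A positive gap means that the first value is not tested, so it contributes a bare factor `R`.
  total-misses (suc g ∷ gs) m c = begin
    sum {R} (λ _ → t) * p ≡⟨ cong (_* p) (sum-const R t) ⟩
    R * t * p             ≡⟨ *-assoc R t p ⟩
    R * (t * p)           ≡⟨ cong (R *_) (total-misses (g ∷ gs) m c) ⟩
    R * (R ^ (span (g ∷ gs) + m) * q) ≡⟨ *-assoc R (R ^ (span (g ∷ gs) + m)) q ⟨
    R ^ (span (suc g ∷ gs) + m) * q   ∎
    where
    open ≡-Reasoning
    t p q : ℕ
    t = total (span (g ∷ gs) + m) (misses (g ∷ gs) c)
    p = (R * R) ^ suc (length gs)
    q = (R * R ∸ 1) ^ suc (length gs)
  total-misses (zero ∷ gs) m c = begin
    sum (λ a → sum (λ b → total n (λ τ → if does (a ≟ c) ∧ does (b ≟ c) then 0 else misses gs c τ))) * p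
      ≡⟨ cong (_* p) (sum-cong-≗ (λ a → sum-cong-≗ (λ b →
           total-if n (does (a ≟ c) ∧ does (b ≟ c)) (misses gs c)))) ⟩
    sum (λ a → sum (λ b → if does (a ≟ c) ∧ does (b ≟ c) then 0 else t)) * p
      ≡⟨ cong (_* p) (sum-pair c t) ⟩
    (R * R ∸ 1) * t * (R * R * (R * R) ^ length gs)
      ≡⟨ rearrange (R * R ∸ 1) t (R * R) _ ⟩
    (R * R ∸ 1) * (R * R) * (t * (R * R) ^ length gs)
      ≡⟨ cong ((R * R ∸ 1) * (R * R) *_) (total-misses gs m c) ⟩
    (R * R ∸ 1) * (R * R) * (R ^ n * (R * R ∸ 1) ^ length gs)
      ≡⟨ rearrange′ (R * R ∸ 1) R (R ^ n) _ ⟩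
    R * (R * R ^ n) * ((R * R ∸ 1) * (R * R ∸ 1) ^ length gs) ∎
    where
    open ≡-Reasoning
    n t p : ℕ
    n = span gs + m
    t = total n (misses gs c)
    p = (R * R) ^ suc (length gs)

    rearrange : ∀ a b c d → a * b * (c * d) ≡ a * c * (b * d)
    rearrange = solve-∀

    rearrange′ : ∀ a b c d → a * (b * b) * (c * d) ≡ b * (b * c) * (a * d)
    rearrange′ = solve-∀

  -- Encodes the pairs at `β 0`, ..., `β (s - 1)` for `misses`; the offset is the first position not
  -- yet read.
  gaps : (ℕ → ℕ) → (offset s : ℕ) → List ℕ
  gaps β o zero    = []
  gaps β o (suc s) = (β 0 ∸ o) ∷ gaps (λ i → β (suc i)) (2 + β 0) s

  length-gaps : ∀ β o s → length (gaps β o s) ≡ s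
  length-gaps β o zero    = refl
  length-gaps β o (suc s) = cong suc (length-gaps _ _ s)

  misses-∷≡0 : ∀ g gs c (τ : ℕ → Fin R) → misses (g ∷ gs) c τ ≡ 0 →
               (τ g ≡ c × τ (suc g) ≡ c) ⊎ misses gs c (λ n → τ (2 + g + n)) ≡ 0
  misses-∷≡0 g gs c τ eq with τ g ≟ c | τ (suc g) ≟ c
  ... | yes p | yes q = inj₁ (p , q)
  ... | yes _ | no _  = inj₂ eq
  ... | no _  | _     = inj₂ eq

  -- `misses` passes on only the tail of the sequence, so the induction needs a `σ` that is `τ`
  -- shifted by the offset.
  misses-gaps≡0 : ∀ s β o c (τ σ : ℕ → Fin R) → (∀ n → σ n ≡ τ (o + n)) →
                  o ≤ β 0 → (∀ i → 2 + β i ≤ β (suc i)) → misses (gaps β o s) c σ ≡ 0 →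
                  ∃ λ i → i < s × τ (β i) ≡ c × τ (suc (β i)) ≡ c
  misses-gaps≡0 (suc s) β o c τ σ σ≗τ o≤β gap eq
    with misses-∷≡0 (β 0 ∸ o) (gaps (λ i → β (suc i)) (2 + β 0) s) c σ eq
  ... | inj₁ (p , q) = 0 , z<s
      , trans (sym (trans (σ≗τ _) (cong τ β₀))) p
      , trans (sym (trans (σ≗τ _) (cong τ (trans (+-suc o _) (cong suc β₀))))) q
    where
    β₀ : o + (β 0 ∸ o) ≡ β 0
    β₀ = m+[n∸m]≡n o≤β
  ... | inj₂ eq′ =
    let (i , i<s , h) = misses-gaps≡0 s (λ i → β (suc i)) (2 + β 0) c τ _ shifted
                          (gap 0) (λ i → gap (suc i)) eq′
    in suc i , s<s i<s , h
    where
    move : ∀ o g n → o + (2 + g + n) ≡ 2 + (o + g) + n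
    move = solve-∀

    shifted : ∀ n → σ (2 + (β 0 ∸ o) + n) ≡ τ (2 + β 0 + n)
    shifted n = trans (σ≗τ _) (cong τ (trans (move o (β 0 ∸ o) n)
      (cong (λ b → 2 + b + n) (m+[n∸m]≡n o≤β))))

  -- Union bound: `few` says that the expected number of missed combinations of a sequence `β j`
  -- with a colour is below 1.
  hitting : ∀ {M} s (β : Fin M → ℕ → ℕ) → (∀ j i → 2 + β j i ≤ β j (suc i)) →
            M * (R * (R * R ∸ 1) ^ s) < (R * R) ^ s →
            ∃ λ (τ : ℕ → Fin R) → ∀ j c → ∃ λ i → i < s × τ (β j i) ≡ c × τ (suc (β j i)) ≡ c
  hitting {M} s β gap few =
    let (τ , zeros) = total-<⇒∃zero m bad bad<
    in τ , λ j c → misses-gaps≡0 s (β j) 0 c τ τ (λ _ → refl) z≤n (gap j)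
         (sum≡0⇒term≡0 (λ c → misses (tests j) c τ)
           (sum≡0⇒term≡0 (λ j → sum (λ c → misses (tests j) c τ)) zeros j) c)
    where
    tests : Fin M → List ℕ
    tests j = gaps (β j) 0 s

    m : ℕ
    -- A common length that covers every test; `total-misses` allows surplus positions after a test.
    m = sum (λ j → span (tests j))

    bad : (ℕ → Fin R) → ℕ
    bad τ = sum (λ j → sum (λ c → misses (tests j) c τ))

    p q : ℕ
    p = (R * R) ^ s
    q = (R * R ∸ 1) ^ s

    t : Fin M → Fin R → ℕ
    t j c = total m (misses (tests j) c)

    one : ∀ j c → t j c * p ≡ R ^ m * q
    one j c = subst₂ (λ m′ s′ → total m′ (misses (tests j) c) * (R * R) ^ s′
                              ≡ R ^ m′ * (R * R ∸ 1) ^ s′)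
      (m+[n∸m]≡n (term≤sum (λ j → span (tests j)) j)) (length-gaps (β j) 0 s)
      (total-misses (tests j) (m ∸ span (tests j)) c)

    bad-total : total m bad * p ≡ R ^ m * (M * (R * q))
    bad-total = begin
      total m bad * p
        ≡⟨ cong (_* p) (trans (total-sum m (λ j τ → sum (λ c → misses (tests j) c τ)))
             (sum-cong-≗ (λ j → total-sum m (misses (tests j))))) ⟩
      sum (λ j → sum (t j)) * p
        ≡⟨ *-distribʳ-sum p (λ j → sum (t j)) ⟩
      sum (λ j → sum (t j) * p)
        ≡⟨ sum-cong-≗ (λ j → trans (*-distribʳ-sum p (t j)) (sum-cong-≗ (one j))) ⟩
      sum {M} (λ j → sum {R} (λ c → R ^ m * q))
        ≡⟨ trans (sum-cong-≗ {M} (λ j → sum-const R (R ^ m * q))) (sum-const M _) ⟩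
      M * (R * (R ^ m * q))
        ≡⟨ rearrange M R (R ^ m) q ⟩
      R ^ m * (M * (R * q)) ∎
      where
      open ≡-Reasoning
      rearrange : ∀ a b c d → a * (b * (c * d)) ≡ c * (a * (b * d))
      rearrange = solve-∀

    bad< : total m bad < R ^ m
    bad< = *-cancelʳ-< p _ _ (≤-<-trans (≤-reflexive bad-total)
      (*-monoʳ-< (R ^ m) {{m^n≢0 R m}} few))

-- Waves, their growth, and wave-free colourings

-- Only the first k terms have to satisfy P; the sequence is prolonged beyond
-- them so that its laws hold at every index.
record Wave (k : ℕ) (P : ℕ → Set) : Set where
  field
    term diff : ℕ → ℕ
    term-suc  : ∀ i → term (suc i) ≡ term i + diff i
    diff-pos  : 0 < diff 0
    diff-suc  : ∀ i → diff i ≤ diff (suc i)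
    satisfies : ∀ {i} → i < k → P (term i)

  diff-mono : ∀ {i j} → i ≤ j → diff i ≤ diff j
  diff-mono {i} {j} i≤j = subst (λ j → diff i ≤ diff j) (m+[n∸m]≡n i≤j) (go (j ∸ i))
    where
    go : ∀ n → diff i ≤ diff (i + n)
    go zero    = ≤-reflexive (cong diff (sym (+-identityʳ i)))
    go (suc n) = ≤-trans (go n) (≤-trans (diff-suc (i + n)) (≤-reflexive (cong diff (sym (+-suc i n)))))

  -- Convexity keeps the wave above the progression from `term a` with difference `diff a`; `term-≤`
  -- is the matching upper progression, with a later difference.
  term-≥ : ∀ a n → term a + n * diff a ≤ term (a + n)
  term-≥ a zero    = ≤-reflexive (trans (+-identityʳ _) (cong term (sym (+-identityʳ a))))
  term-≥ a (suc n) = begin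
    term a + (diff a + n * diff a)  ≡⟨ swap (term a) (diff a) (n * diff a) ⟩
    term a + n * diff a + diff a    ≤⟨ +-mono-≤ (term-≥ a n) (diff-mono (m≤m+n a n)) ⟩
    term (a + n) + diff (a + n)     ≡⟨ term-suc (a + n) ⟨
    term (suc (a + n))              ≡⟨ cong term (+-suc a n) ⟨
    term (a + suc n)                ∎
    where
    open ≤-Reasoning
    swap : ∀ x y z → x + (y + z) ≡ x + z + y
    swap = solve-∀

  term-≤ : ∀ a {m} n → n ≤ m → term (a + n) ≤ term a + n * diff (a + m)
  term-≤ a zero    n≤m = ≤-reflexive (trans (cong term (+-identityʳ a)) (sym (+-identityʳ _)))
  term-≤ a {m} (suc n) n<m = begin
    term (a + suc n)                ≡⟨ cong term (+-suc a n) ⟩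
    term (suc (a + n))              ≡⟨ term-suc (a + n) ⟩
    term (a + n) + diff (a + n)     ≤⟨ +-mono-≤ (term-≤ a n (<⇒≤ n<m)) (diff-mono (+-monoʳ-≤ a (<⇒≤ n<m))) ⟩
    term a + n * d + d              ≡⟨ swap (term a) (n * d) d ⟩
    term a + (d + n * d)            ∎
    where
    open ≤-Reasoning
    d : ℕ
    d = diff (a + m)
    swap : ∀ x y z → x + y + z ≡ x + (z + y)
    swap = solve-∀

  term-mono : ∀ {i j} → i ≤ j → term i ≤ term j
  term-mono {i} {j} i≤j = begin
    term i                        ≤⟨ m≤m+n _ _ ⟩
    term i + (j ∸ i) * diff i     ≤⟨ term-≥ i (j ∸ i) ⟩
    term (i + (j ∸ i))            ≡⟨ cong term (m+[n∸m]≡n i≤j) ⟩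
    term j                        ∎
    where open ≤-Reasoning

record WaveFree (r k N : ℕ) : Set where
  field
    colour : ℕ → Fin r
    free   : ∀ c → ¬ Wave k (λ x → x < N × colour x ≡ c)

waveFree-mono : ∀ {r k k′ N} → k ≤ k′ → WaveFree r k N → WaveFree r k′ N
waveFree-mono k≤k′ G = record
  { colour = G.colour
  ; free   = λ c W → let open Wave W in G.free c record
      { term = term ; diff = diff ; term-suc = term-suc ; diff-pos = diff-pos
      ; diff-suc = diff-suc ; satisfies = λ i<k → satisfies (<-≤-trans i<k k≤k′) }
  }
  where module G = WaveFree G

-- Blocks of length `B` and the blocks met by progressions

module _ (B : ℕ) .{{_ : NonZero B}} where

  [m+n*B]/B≡m/B+n : ∀ m n → (m + n * B) ÷ B ≡ m ÷ B + n
  [m+n*B]/B≡m/B+n m n = trans (+-distrib-/-∣ʳ m (n∣m*n n)) (cong (m ÷ B +_) (m*n/n≡m n B))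

  [m+B]/B≡1+m/B : ∀ m → (m + B) ÷ B ≡ suc (m ÷ B)
  [m+B]/B≡1+m/B m = begin
    (m + B) ÷ B      ≡⟨ cong (λ x → (m + x) ÷ B) (sym (*-identityˡ B)) ⟩
    (m + 1 * B) ÷ B  ≡⟨ [m+n*B]/B≡m/B+n m 1 ⟩
    m ÷ B + 1        ≡⟨ +-comm _ 1 ⟩
    suc (m ÷ B)      ∎
    where open ≡-Reasoning

  -- A shift by less than `B` crosses at most one block boundary. This is why a typical `τ` takes
  -- the colour on two consecutive blocks.
  near-quotient : ∀ {x y} → x ≤ y → y < x + B → y ÷ B ≡ x ÷ B ⊎ y ÷ B ≡ suc (x ÷ B)
  near-quotient {x} {y} x≤y y<x+B with m≤n⇒m<n∨m≡n (/-monoˡ-≤ B x≤y)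
  ... | inj₂ eq = inj₁ (sym eq)
  ... | inj₁ lt = inj₂ (≤-antisym
    (≤-trans (/-monoˡ-≤ B (<⇒≤ y<x+B)) (≤-reflexive ([m+B]/B≡1+m/B x))) lt)

  -- β x d enumerates the blocks of the progression with first term x and
  -- difference 2 (B + d).
  β : (x d i : ℕ) → ℕ
  β x d i = (x + i * (2 * d)) ÷ B + 2 * i

  -- Makes the pairs `β i`, `β i + 1` disjoint, as the counting argument requires.
  β-gap : ∀ x d i → 2 + β x d i ≤ β x d (suc i)
  β-gap x d i = begin
    2 + β x d i                             ≡⟨ move ((x + i * (2 * d)) ÷ B) i ⟩
    (x + i * (2 * d)) ÷ B + 2 * suc i       ≤⟨ +-monoˡ-≤ (2 * suc i)
      (/-monoˡ-≤ B (+-monoʳ-≤ x (m≤n+m (i * (2 * d)) (2 * d)))) ⟩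
    (x + suc i * (2 * d)) ÷ B + 2 * suc i   ∎
    where
    open ≤-Reasoning
    move : ∀ q i → 2 + (q + 2 * i) ≡ q + 2 * suc i
    move = solve-∀

  β-progression : ∀ x d i → (x + (2 * i) * (B + d)) ÷ B ≡ β x d i
  β-progression x d i = trans (cong (_÷ B) (expand x d i B)) ([m+n*B]/B≡m/B+n _ (2 * i))
    where
    expand : ∀ x d i B → x + (2 * i) * (B + d) ≡ x + i * (2 * d) + (2 * i) * B
    expand = solve-∀

-- Monochromatic waves in the mixture of `χ` and `τ`

module Mixture {r u B : ℕ} .{{_ : NonZero B}} (G : WaveFree r u B) (τ : ℕ → Fin (suc r)) where

  open WaveFree G using () renaming (colour to χ; free to χ-free)

  mixture : ℕ → Fin (suc r)
  mixture x = punchIn (τ (x ÷ B)) (χ (x % B))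

  module _ {k N : ℕ} {c : Fin (suc r)} (W : Wave k (λ x → x < N × mixture x ≡ c)) where

    open Wave W

    avoids : ∀ {i} → i < k → τ (term i ÷ B) ≢ c
    avoids i<k eq = punchInᵢ≢i (τ _) _ (trans (proj₂ (satisfies i<k)) (sym eq))

    -- Otherwise `u` consecutive terms share a block, and translating them into [0,B) gives a
    -- `u`-term wave that is monochromatic for `χ`.
    leaves-block : ∀ a → a + u ≤ k → term a ÷ B < term (a + u) ÷ B
    leaves-block a a+u≤k with term a ÷ B <? term (a + u) ÷ B
    ... | yes lt = lt
    ... | no ≮   = contradiction inside (χ-free (χ (term a % B)))
      where
      b : ℕ
      b = term a ÷ B

      index : ∀ {i} → i < u → a + i < k
      index i<u = <-≤-trans (+-monoʳ-< a i<u) a+u≤k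

      quotient : ∀ {i} → i < u → term (a + i) ÷ B ≡ b
      quotient i<u = ≤-antisym
        (≤-trans (/-monoˡ-≤ B (term-mono (+-monoʳ-≤ a (<⇒≤ i<u)))) (≮⇒≥ ≮))
        (/-monoˡ-≤ B (term-mono (m≤m+n a _)))

      remainder : ∀ {i} → i < u → term (a + i) ∸ b * B ≡ term (a + i) % B
      remainder i<u = trans (cong (λ q → _ ∸ q * B) (sym (quotient i<u))) (sym (m%n≡m∸m/n*n _ B))

      bB≤ : ∀ i → b * B ≤ term (a + i)
      bB≤ i = ≤-trans (m/n*n≤m (term a) B) (term-mono (m≤m+n a i))

      same-colour : ∀ {i} → i < u → χ (term (a + i) % B) ≡ χ (term a % B)
      -- Inside one block the omitted colour is fixed, so equal mixed colours come from equal
      -- colours of `χ`.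
      same-colour {i} i<u = punchIn-injective (τ b) _ _ (begin
        punchIn (τ b) (χ (term (a + i) % B))
          ≡⟨ cong (λ q → punchIn (τ q) (χ (term (a + i) % B))) (quotient i<u) ⟨
        mixture (term (a + i))
          ≡⟨ proj₂ (satisfies (index i<u)) ⟩
        c
          ≡⟨ proj₂ (satisfies (≤-<-trans (m≤m+n a i) (index i<u))) ⟨
        mixture (term a) ∎)
        where open ≡-Reasoning

      inside : Wave u (λ x → x < B × χ x ≡ χ (term a % B))
      inside = record
        { term      = λ i → term (a + i) ∸ b * B
        ; diff      = λ i → diff (a + i)
        ; term-suc  = λ i → begin
            term (a + suc i) ∸ b * B             ≡⟨ cong (λ j → term j ∸ b * B) (+-suc a i) ⟩
            term (suc (a + i)) ∸ b * B           ≡⟨ cong (_∸ b * B) (term-suc (a + i)) ⟩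
            term (a + i) + diff (a + i) ∸ b * B  ≡⟨ +-∸-comm (diff (a + i)) (bB≤ i) ⟩
            term (a + i) ∸ b * B + diff (a + i)  ∎
        ; diff-pos  = ≤-trans diff-pos (diff-mono z≤n)
        ; diff-suc  = λ i → ≤-trans (diff-suc (a + i)) (≤-reflexive (cong diff (sym (+-suc a i))))
        ; satisfies = λ {i} i<u →
            subst (_< B) (sym (remainder i<u)) (m%n<n (term (a + i)) B)
          , trans (cong χ (remainder i<u)) (same-colour i<u)
        }
        where open ≡-Reasoning

    crosses-blocks : ∀ n → n * u ≤ k → term 0 ÷ B + n ≤ term (n * u) ÷ B
    crosses-blocks zero    _     = ≤-reflexive (+-identityʳ _)
    crosses-blocks (suc n) nu≤k = begin
      term 0 ÷ B + suc n    ≡⟨ +-suc _ n ⟩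
      suc (term 0 ÷ B + n)  ≤⟨ s≤s (crosses-blocks n (≤-trans (m≤n+m (n * u) u) nu≤k)) ⟩
      suc (term (n * u) ÷ B) ≤⟨ leaves-block (n * u) (≤-trans (≤-reflexive (+-comm (n * u) u)) nu≤k) ⟩
      term (n * u + u) ÷ B  ≡⟨ cong (λ j → term j ÷ B) (+-comm (n * u) u) ⟩
      term (u + n * u) ÷ B  ∎
      where open ≤-Reasoning

    -- Steps shorter than `B` cannot jump over a block.
    visits : ∀ n → diff n < B → ∀ b → term 0 ÷ B ≤ b → b ≤ term n ÷ B →
             ∃ λ j → j ≤ n × term j ÷ B ≡ b
    visits zero    _   b lo hi = 0 , z≤n , ≤-antisym lo hi
    visits (suc n) d<B b lo hi with b ≤? term n ÷ B
    ... | yes b≤ = let (j , j≤n , eq) = visits n (≤-<-trans (diff-suc n) d<B) b lo b≤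
                   in j , m≤n⇒m≤1+n j≤n , eq
    ... | no b≰  = suc n , ≤-refl , ≤-antisym one-block hi
      where
      open ≤-Reasoning
      one-block : term (suc n) ÷ B ≤ b
      one-block = begin
        term (suc n) ÷ B       ≡⟨ cong (_÷ B) (term-suc n) ⟩
        (term n + diff n) ÷ B  ≤⟨ /-monoˡ-≤ B (+-monoʳ-≤ (term n) (<⇒≤ (≤-<-trans (diff-suc n) d<B))) ⟩
        (term n + B) ÷ B       ≡⟨ [m+B]/B≡1+m/B B (term n) ⟩
        suc (term n ÷ B)       ≤⟨ ≰⇒> b≰ ⟩
        b                      ∎

  module Hitting {s N : ℕ} (hits : ∀ {x d} → x < N → d < N → ∀ c →
                 ∃ λ i → i < s × τ (β B x d i) ≡ c × τ (suc (β B x d i)) ≡ c) where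

    module _ {k : ℕ} {c : Fin (suc r)} (W : Wave k (λ x → x < N × mixture x ≡ c)) where

      open Wave W

      private
        m : ℕ
        m = 2 * s

      becomes-long : m * u < k → B ≤ diff (m * u)
      becomes-long mu<k with B ≤? diff (m * u)
      ... | yes B≤ = B≤
      -- The progression of difference `2 * B` from the first term occupies every second block. The
      -- wave crosses `2 * s` blocks and visits each on its way, so it meets the block supplied by
      -- `hits`.
      ... | no B≰  with hits {term 0} {0} term₀<N (≤-<-trans z≤n term₀<N) c
        where
        term₀<N : term 0 < N
        term₀<N = proj₁ (satisfies (≤-<-trans z≤n mu<k))
      ... | i , i<s , eq , _ =
        let (j , j≤ , eq′) = visits W (m * u) (≰⇒> B≰) (β B (term 0) 0 i)
              (≤-trans (≤-reflexive (cong (_÷ B) (sym start))) (m≤m+n _ (2 * i)))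
              (≤-trans (≤-reflexive (cong (λ x → x ÷ B + 2 * i) start))
                (≤-trans (+-monoʳ-≤ (term 0 ÷ B) (*-monoʳ-≤ 2 (<⇒≤ i<s)))
                  (crosses-blocks W m (<⇒≤ mu<k))))
        in contradiction (trans (cong τ eq′) eq) (avoids W (≤-<-trans j≤ mu<k))
        where
        start : term 0 + i * 0 ≡ term 0
        start = trans (cong (term 0 +_) (*-zeroʳ i)) (+-identityʳ _)

      s>0 : 0 < k → 0 < s
      s>0 k>0 = let term₀<N = proj₁ (satisfies k>0)
                    (_ , i<s , _) = hits term₀<N term₀<N c
                in ≤-<-trans z≤n i<s

      accelerates : ∀ a → a + m < k → B ≤ diff a → m * diff a + B ≤ m * diff (a + m)
      accelerates a a+m<k B≤ with m * diff a + B ≤? m * diff (a + m)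
      ... | yes ok = ok
      -- Every second term of the wave is compared with a progression of difference `2 * diff a`,
      -- which is `2 * (B + (diff a ∸ B))`.
      ... | no ≰   with hits {term a} {diff a ∸ B} term<N diff<N c
        where
        open ≤-Reasoning
        term<N : term a < N
        term<N = proj₁ (satisfies (≤-<-trans (m≤m+n a m) a+m<k))

        1≤m : 1 ≤ m
        1≤m = ≤-trans (s>0 (≤-<-trans z≤n a+m<k)) (m≤n*m s 2)

        diff<N : diff a ∸ B < N
        diff<N = begin-strict
          diff a ∸ B       ≤⟨ m∸n≤m (diff a) B ⟩
          diff a           ≤⟨ m≤n+m (diff a) (term a) ⟩
          term a + diff a  ≡⟨ term-suc a ⟨
          term (suc a)     <⟨ proj₁ (satisfies (≤-<-trans
            (≤-trans (≤-reflexive (+-comm 1 a)) (+-monoʳ-≤ a 1≤m)) a+m<k)) ⟩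
          N                ∎
      ... | i , i<s , eq₁ , eq₂ = contradiction meets-c (avoids W index)
        where
        open ≤-Reasoning
        d g x y : ℕ
        d = diff a
        g = diff (a + m) ∸ diff a
        x = term a + (2 * i) * d
        y = term (a + 2 * i)

        2i≤m : 2 * i ≤ m
        2i≤m = *-monoʳ-≤ 2 (<⇒≤ i<s)

        index : a + 2 * i < k
        index = ≤-<-trans (+-monoʳ-≤ a 2i≤m) a+m<k

        d+g : d + g ≡ diff (a + m)
        d+g = m+[n∸m]≡n (diff-mono (m≤m+n a m))

        mg<B : m * g < B
        mg<B = +-cancelˡ-< (m * d) _ _ (begin-strict
          m * d + m * g     ≡⟨ *-distribˡ-+ m d g ⟨
          m * (d + g)       ≡⟨ cong (m *_) d+g ⟩
          m * diff (a + m)  <⟨ ≰⇒> ≰ ⟩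
          m * d + B         ∎)

        -- At most `m` steps, each exceeding `d` by at most `g`, drift less than `B` away from the
        -- progression.
        y<x+B : y < x + B
        y<x+B = begin-strict
          y                                      ≤⟨ term-≤ a (2 * i) 2i≤m ⟩
          term a + (2 * i) * diff (a + m)        ≡⟨ cong (λ e → term a + (2 * i) * e) d+g ⟨
          term a + (2 * i) * (d + g)             ≡⟨ expand (term a) (2 * i) d g ⟩
          x + (2 * i) * g                        ≤⟨ +-monoʳ-≤ x (*-monoˡ-≤ g 2i≤m) ⟩
          x + m * g                              <⟨ +-monoʳ-< x mg<B ⟩
          x + B                                  ∎
          where
          expand : ∀ t n d g → t + n * (d + g) ≡ t + n * d + n * g
          expand = solve-∀

        x/B : x ÷ B ≡ β B (term a) (d ∸ B) i
        x/B = trans (cong (λ e → (term a + (2 * i) * e) ÷ B) (sym (m+[n∸m]≡n B≤)))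
                    (β-progression B (term a) (d ∸ B) i)

        meets-c : τ (y ÷ B) ≡ c
        meets-c with near-quotient B (term-≥ a (2 * i)) y<x+B
        ... | inj₁ eq = trans (cong τ (trans eq x/B)) eq₁
        ... | inj₂ eq = trans (cong τ (trans eq (cong suc x/B))) eq₂

      -- After the first `u * m` steps the differences are at least `B`, so `accelerates` applies
      -- `n` times, once for each further `m` steps.
      speeds-up : ∀ n → (u + n) * m < k → B ≤ diff (m * u) → n * B ≤ m * diff ((u + n) * m)
      speeds-up zero    _  _  = z≤n
      speeds-up (suc n) lt B≤ = begin
        B + n * B                       ≡⟨ +-comm B (n * B) ⟩
        n * B + B                       ≤⟨ +-monoˡ-≤ B (speeds-up n
          (≤-<-trans (m≤m+n _ m) a+m<k) B≤) ⟩
        m * diff a + B                  ≤⟨ accelerates a a+m<k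
          (≤-trans B≤ (diff-mono (≤-trans (≤-reflexive (*-comm m u)) (*-monoˡ-≤ m (m≤m+n u n))))) ⟩
        m * diff (a + m)                ≡⟨ cong (λ j → m * diff j) a+m ⟩
        m * diff ((u + suc n) * m)      ∎
        where
        open ≤-Reasoning
        a : ℕ
        a = (u + n) * m

        a+m : a + m ≡ (u + suc n) * m
        a+m = expand u n m
          where
          expand : ∀ u n m → (u + n) * m + m ≡ (u + suc n) * m
          expand = solve-∀

        a+m<k : a + m < k
        a+m<k = subst (_< k) (sym a+m) lt

    -- Three phases of `u * (2 * s)` steps: the difference reaches `B`, then `u * B / (2 * s)`, and
    -- the last phase at that speed covers `u * u * B`.
    mixture-free : ∀ {k} → N ≤ u * u * B → 3 * (u * (2 * s)) < k →
                   ∀ c → ¬ Wave k (λ x → x < N × mixture x ≡ c)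
    mixture-free {k} N≤ len c W = <⇒≱ (proj₁ (satisfies end<k))
      (*-cancelˡ-≤ m {{m≢0}} (begin
        m * N                             ≤⟨ *-monoʳ-≤ m N≤ ⟩
        m * (u * u * B)                   ≡⟨ regroup m u B ⟩
        (u * m) * (u * B)                 ≤⟨ *-monoʳ-≤ (u * m) (speeds-up W u
          (≤-<-trans (m≤m+n a (u * m)) end<k)
          (becomes-long W (≤-<-trans first≤ end<k))) ⟩
        (u * m) * (m * diff a)            ≡⟨ regroup′ u m (diff a) ⟩
        m * ((u * m) * diff a)            ≤⟨ *-monoʳ-≤ m (≤-trans (m≤n+m _ (term a)) (term-≥ a (u * m))) ⟩
        m * term (a + u * m)              ∎))
      where
      open Wave W
      open ≤-Reasoning
      m a : ℕ
      m = 2 * s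
      a = (u + u) * m

      end<k : a + u * m < k
      end<k = subst (_< k) (expand u m) len
        where
        expand : ∀ u m → 3 * (u * m) ≡ (u + u) * m + u * m
        expand = solve-∀

      first≤ : m * u ≤ a + u * m
      first≤ = ≤-trans (≤-reflexive (*-comm m u)) (m≤n+m (u * m) a)

      m≢0 : NonZero m
      m≢0 = >-nonZero (≤-trans (s>0 W (≤-<-trans z≤n len)) (m≤n*m s 2))

      regroup : ∀ m u B → m * (u * u * B) ≡ (u * m) * (u * B)
      regroup = solve-∀

      regroup′ : ∀ u m d → (u * m) * (m * d) ≡ m * ((u * m) * d)
      regroup′ = solve-∀

waveFree-suc : ∀ {r u B} s N → 0 < B → WaveFree r u B → N ≤ u * u * B →
               N * N * (suc r * (suc r * suc r ∸ 1) ^ s) < (suc r * suc r) ^ s →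
               WaveFree (suc r) (suc (3 * (u * (2 * s)))) N
waveFree-suc {r} {u} {B} s N B>0 G N≤ few = record
  { colour = mixture
  ; free   = Hitting.mixture-free hits N≤ ≤-refl
  }
  where
  instance
    B≢0 : NonZero B
    B≢0 = >-nonZero B>0

  -- First terms and difference parameters below `N` are packed into one index, giving the `N * N`
  -- sequences for `hitting`.
  test : Fin (N * N) → ℕ → ℕ
  test j = let (x , d) = remQuot {N} N j in β B (toℕ x) (toℕ d)

  found : ∃ λ τ → ∀ j c → ∃ λ i → i < s × τ (test j i) ≡ c × τ (suc (test j i)) ≡ c
  found = hitting s test
    (λ j → let (x , d) = remQuot {N} N j in β-gap B (toℕ x) (toℕ d)) few

  τ : ℕ → Fin (suc r)
  τ = proj₁ found

  open Mixture G τ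

  hits : ∀ {x d} → x < N → d < N → ∀ c →
         ∃ λ i → i < s × τ (β B x d i) ≡ c × τ (suc (β B x d i)) ≡ c
  hits {x} {d} x<N d<N c =
    subst (λ b → ∃ λ i → i < s × τ (b i) ≡ c × τ (suc (b i)) ≡ c)
      eq (proj₂ found (combine x′ d′) c)
    where
    x′ d′ : Fin N
    x′ = fromℕ< x<N
    d′ = fromℕ< d<N

    eq : test (combine x′ d′) ≡ β B x d
    eq = trans (cong (λ p → β B (toℕ (proj₁ p)) (toℕ (proj₂ p))) (remQuot-combine x′ d′))
               (cong₂ (β B) (toℕ-fromℕ< x<N) (toℕ-fromℕ< d<N))

-- Elementary inequalities for the union bound

n<2^n : ∀ n → n < 2 ^ n
n<2^n zero    = z<s
n<2^n (suc n) = begin-strict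
  suc n            <⟨ s<s (n<2^n n) ⟩
  1 + 2 ^ n        ≤⟨ +-monoˡ-≤ (2 ^ n) (m^n>0 2 n) ⟩
  2 ^ n + 2 ^ n    ≡⟨ cong (2 ^ n +_) (sym (+-identityʳ _)) ⟩
  2 ^ suc n        ∎
  where open ≤-Reasoning

^-distribʳ-* : ∀ m n o → (m * n) ^ o ≡ m ^ o * n ^ o
^-distribʳ-* m n zero    = refl
^-distribʳ-* m n (suc o) = trans (cong (m * n *_) (^-distribʳ-* m n o)) (swap m n (m ^ o) (n ^ o))
  where
  swap : ∀ a b c d → a * b * (c * d) ≡ a * c * (b * d)
  swap = solve-∀

-- The left side consists of the two leading terms of the binomial expansion of the right side.
bernoulli : ∀ n m → n ^ suc m + suc m * n ^ m ≤ suc n ^ suc m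
bernoulli n zero    = ≤-reflexive (base n)
  where
  base : ∀ n → n * 1 + 1 * 1 ≡ suc n * 1
  base = solve-∀
bernoulli n (suc m) = begin
  n ^ suc (suc m) + suc (suc m) * n ^ suc m           ≤⟨ m≤m+n _ (suc m * n ^ m) ⟩
  n * (n * p) + suc (suc m) * (n * p) + suc m * p     ≡⟨ factor n m p ⟩
  suc n * (n ^ suc m + suc m * n ^ m)                 ≤⟨ *-monoʳ-≤ (suc n) (bernoulli n m) ⟩
  suc n ^ suc (suc m)                                 ∎
  where
  open ≤-Reasoning
  p : ℕ
  p = n ^ m
  factor : ∀ n m p → n * (n * p) + suc (suc m) * (n * p) + suc m * p ≡ suc n * (n * p + suc m * p)
  factor = solve-∀

-- At `m = n` the second term of `bernoulli` is already at least `n ^ suc n`.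
2*n^[1+n]≤[1+n]^[1+n] : ∀ n → 2 * n ^ suc n ≤ suc n ^ suc n
2*n^[1+n]≤[1+n]^[1+n] n = ≤-trans
  (+-monoʳ-≤ (n ^ suc n) (≤-trans (≤-reflexive (+-identityʳ _)) (*-monoˡ-≤ (n ^ n) (n≤1+n n))))
  (bernoulli n n)

-- Every `suc n` trials with failure probability `n / suc n` at least halve the chance that all
-- fail, so `L` such rounds outweigh `M` events.
union-bound : ∀ n L M .{{_ : NonZero n}} → M < 2 ^ L → M * n ^ (suc n * L) < suc n ^ (suc n * L)
union-bound n L M M<2^L = begin-strict
  M * n ^ (suc n * L)          <⟨ *-monoˡ-< (n ^ (suc n * L)) {{m^n≢0 n (suc n * L)}} M<2^L ⟩
  2 ^ L * n ^ (suc n * L)      ≡⟨ cong (2 ^ L *_) (^-*-assoc n (suc n) L) ⟨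
  2 ^ L * (n ^ suc n) ^ L      ≡⟨ ^-distribʳ-* 2 (n ^ suc n) L ⟨
  (2 * n ^ suc n) ^ L          ≤⟨ ^-monoˡ-≤ L (2*n^[1+n]≤[1+n]^[1+n] n) ⟩
  (suc n ^ suc n) ^ L          ≡⟨ ^-*-assoc (suc n) (suc n) L ⟩
  suc n ^ (suc n * L)          ∎
  where open ≤-Reasoning

-- Induction on the number of colours

waveFree-1 : ∀ u → WaveFree 1 (suc u) u
waveFree-1 u = record
  { colour = λ _ → zero
  ; free   = λ c W → let open Wave W in
      -- The `u` steps of length at least 1 lead out of [0,u).
      <⇒≱ (proj₁ (satisfies ≤-refl))
          (≤-trans (m≤m*n u (diff 0) {{>-nonZero diff-pos}})
            (≤-trans (m≤n+m _ (term 0)) (term-≥ 0 u)))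
  }

module _ {ρ L u : ℕ} .{{_ : NonZero L}} .{{_ : NonZero u}}
         (few : u ^ (2 * ρ) * u ^ (2 * ρ) * ρ < 2 ^ L) where

  -- Each new colour costs a factor `7 * (ρ * ρ * L)` in the number of terms and gains `u * u` in
  -- the range. `ρ` and `L` serve all stages at once, so the cost is the same at each.
  waveFree-power : ∀ r → r < ρ →
                   WaveFree (suc r) ((7 * (ρ * ρ * L)) ^ r * suc u) (u ^ suc (2 * r))
  waveFree-power zero    r<ρ = subst₂ (WaveFree 1) (sym (+-identityʳ (suc u))) (sym (*-identityʳ u)) (waveFree-1 u)
  waveFree-power (suc r) r<ρ = waveFree-mono length≤
    (waveFree-suc s N (m^n>0 u (suc (2 * r))) (waveFree-power r (<⇒≤ r<ρ)) N≤ few′)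
    where
    open ≤-Reasoning
    R s N Q U : ℕ
    R = suc (suc r)
    -- This is `suc n * L` with `n = R * R ∸ 1`, the number of trials in `union-bound`.
    s = R * R * L
    N = u ^ suc (2 * suc r)
    Q = 7 * (ρ * ρ * L)
    U = Q ^ r * suc u

    instance
      ρ≢0 : NonZero ρ
      ρ≢0 = >-nonZero (≤-<-trans z≤n r<ρ)

      ρρL≢0 : NonZero (ρ * ρ * L)
      ρρL≢0 = m*n≢0 (ρ * ρ) L {{m*n≢0 ρ ρ}}

      Q≢0 : NonZero Q
      Q≢0 = m*n≢0 7 (ρ * ρ * L)

      U≢0 : NonZero U
      U≢0 = m*n≢0 (Q ^ r) (suc u) {{m^n≢0 Q r}}

    u≤U : u ≤ U
    u≤U = ≤-trans (n≤1+n u) (m≤n*m (suc u) (Q ^ r) {{m^n≢0 Q r}})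

    N≤ : N ≤ U * U * u ^ suc (2 * r)
    N≤ = begin
      u ^ suc (2 * suc r)       ≡⟨ cong (u ^_) (double r) ⟩
      u * (u * u ^ suc (2 * r)) ≡⟨ *-assoc u u _ ⟨
      u * u * u ^ suc (2 * r)   ≤⟨ *-monoˡ-≤ (u ^ suc (2 * r)) (*-mono-≤ u≤U u≤U) ⟩
      U * U * u ^ suc (2 * r)   ∎
      where
      double : ∀ r → 1 + 2 * (1 + r) ≡ 3 + 2 * r
      double = solve-∀

    N≤u^2ρ : N ≤ u ^ (2 * ρ)
    N≤u^2ρ = ^-monoʳ-≤ u (≤-trans (≤-trans (n≤1+n _) (≤-reflexive (double r))) (*-monoʳ-≤ 2 r<ρ))
      where
      double : ∀ r → 2 + 2 * (1 + r) ≡ 2 * (2 + r)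
      double = solve-∀

    few′ : N * N * (R * (R * R ∸ 1) ^ s) < (R * R) ^ s
    few′ = ≤-<-trans (≤-reflexive (sym (*-assoc (N * N) R _)))
      (union-bound (R * R ∸ 1) L (N * N * R)
        (≤-<-trans (*-mono-≤ (*-mono-≤ N≤u^2ρ N≤u^2ρ) r<ρ) few))

    -- The three phases with `2 * s` give the factor 6; a seventh copy absorbs the `suc`.
    length≤ : suc (3 * (U * (2 * s))) ≤ Q ^ suc r * suc u
    length≤ = begin
      suc (3 * (U * (2 * s)))   ≡⟨ cong suc (six U s) ⟩
      1 + 6 * (U * s)           ≤⟨ +-mono-≤ (>-nonZero⁻¹ (U * t) {{m*n≢0 U t}})
                                     (*-monoʳ-≤ 6 (*-monoʳ-≤ U (*-monoˡ-≤ L (*-mono-≤ r<ρ r<ρ)))) ⟩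
      U * t + 6 * (U * t)       ≡⟨ seven (Q ^ r) (suc u) t ⟩
      7 * t * Q ^ r * suc u     ∎
      where
      t : ℕ
      t = ρ * ρ * L
      six : ∀ U s → 3 * (U * (2 * s)) ≡ 6 * (U * s)
      six = solve-∀
      seven : ∀ q v t → q * v * t + 6 * (q * v * t) ≡ 7 * t * q * v
      seven = solve-∀

-- Of the five shares `ρ * suc e` in the exponent, four pay for the powers of `u` and one for
-- `ρ < 2 ^ ρ`.
few-for-log : ∀ ρ e u → u ≤ 2 ^ suc e →
              u ^ (2 * ρ) * u ^ (2 * ρ) * ρ < 2 ^ (5 * ρ * suc e)
few-for-log ρ e u u≤ = begin-strict
  u ^ (2 * ρ) * u ^ (2 * ρ) * ρ
    ≤⟨ *-monoˡ-≤ ρ (*-mono-≤ power power) ⟩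
  2 ^ (suc e * (2 * ρ)) * 2 ^ (suc e * (2 * ρ)) * ρ
    <⟨ *-monoʳ-< (2 ^ (suc e * (2 * ρ)) * 2 ^ (suc e * (2 * ρ)))
         {{m*n≢0 _ _ {{m^n≢0 2 (suc e * (2 * ρ))}} {{m^n≢0 2 (suc e * (2 * ρ))}}}} (n<2^n ρ) ⟩
  2 ^ (suc e * (2 * ρ)) * 2 ^ (suc e * (2 * ρ)) * 2 ^ ρ
    ≡⟨ trans (^-distribˡ-+-* 2 (suc e * (2 * ρ) + suc e * (2 * ρ)) ρ)
         (cong (_* 2 ^ ρ) (^-distribˡ-+-* 2 (suc e * (2 * ρ)) (suc e * (2 * ρ)))) ⟨
  2 ^ (suc e * (2 * ρ) + suc e * (2 * ρ) + ρ)
    ≤⟨ ^-monoʳ-≤ 2 (≤-trans (m≤m+n _ (ρ * e)) (≤-reflexive (collect ρ e))) ⟩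
  2 ^ (5 * ρ * suc e) ∎
  where
  open ≤-Reasoning
  power : u ^ (2 * ρ) ≤ 2 ^ (suc e * (2 * ρ))
  power = ≤-trans (^-monoˡ-≤ (2 * ρ) u≤) (≤-reflexive (^-*-assoc 2 (suc e) (2 * ρ)))

  collect : ∀ ρ e → suc e * (2 * ρ) + suc e * (2 * ρ) + ρ + ρ * e ≡ 5 * ρ * suc e
  collect = solve-∀

-- Polynomials in the logarithm against exponentials

linear≤exponential : ∀ C f → 3 * C ≤ f → C * suc f ≤ 2 ^ f
linear≤exponential C f 3C≤f =
  subst (λ f → C * suc f ≤ 2 ^ f) (m+[n∸m]≡n 3C≤f) (go (f ∸ 3 * C))
  where
  open ≤-Reasoning
  go : ∀ n → C * suc (3 * C + n) ≤ 2 ^ (3 * C + n)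
  -- At `f = 3 * C` the left side is below the cube of `suc C`, and `suc C ≤ 2 ^ C`. From there on,
  -- raising `f` by 1 at most doubles the left side.
  go zero = begin
    C * suc (3 * C + 0)           ≤⟨ m≤m+n _ _ ⟩
    C * suc (3 * C + 0) + (C * (C * C) + 2 * C + 1)  ≡⟨ cube C ⟩
    suc C ^ 3                     ≤⟨ ^-monoˡ-≤ 3 (n<2^n C) ⟩
    (2 ^ C) ^ 3                   ≡⟨ ^-*-assoc 2 C 3 ⟩
    2 ^ (C * 3)                   ≡⟨ cong (2 ^_) (trans (*-comm C 3) (sym (+-identityʳ _))) ⟩
    2 ^ (3 * C + 0)               ∎
    where
    cube : ∀ C → C * suc (3 * C + 0) + (C * (C * C) + 2 * C + 1) ≡ suc C * (suc C * (suc C * 1))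
    cube = solve-∀
  go (suc n) = begin
    C * suc (3 * C + suc n)       ≤⟨ m≤m+n _ (C * (3 * C + n)) ⟩
    C * suc (3 * C + suc n) + C * (3 * C + n)  ≡⟨ twice C n ⟩
    2 * (C * suc (3 * C + n))     ≤⟨ *-monoʳ-≤ 2 (go n) ⟩
    2 ^ suc (3 * C + n)           ≡⟨ cong (2 ^_) (+-suc (3 * C) n) ⟨
    2 ^ (3 * C + suc n)           ∎
    where
    twice : ∀ C n → C * suc (3 * C + suc n) + C * (3 * C + n) ≡ 2 * (C * suc (3 * C + n))
    twice = solve-∀

m<[1+m/n]*n : ∀ m n .{{_ : NonZero n}} → m < suc (m ÷ n) * n
m<[1+m/n]*n m n = begin-strict
  m                      ≡⟨ m≡m%n+[m/n]*n m n ⟩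
  m % n + (m ÷ n) * n    <⟨ +-monoˡ-< ((m ÷ n) * n) (m%n<n m n) ⟩
  n + (m ÷ n) * n        ∎
  where open ≤-Reasoning

-- Taking `m`-th roots, with `e ÷ m` for the exponent, reduces this to `linear≤exponential` with the
-- constant `A * m`.
polynomial≤exponential : ∀ A m .{{_ : NonZero m}} → ∃ λ E → ∀ e → E ≤ e → (A * suc e) ^ m ≤ 2 ^ e
polynomial≤exponential A m = 3 * (A * m) * m , λ e E≤e →
  let f = e ÷ m
      f≥ : 3 * (A * m) ≤ f
      f≥ = ≤-trans (≤-reflexive (sym (m*n/n≡m (3 * (A * m)) m))) (/-monoˡ-≤ m E≤e)
  in begin
  (A * suc e) ^ m          ≤⟨ ^-monoˡ-≤ m (*-monoʳ-≤ A (m<[1+m/n]*n e m)) ⟩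
  (A * (suc f * m)) ^ m    ≡⟨ cong (_^ m) (regroup A (suc f) m) ⟩
  (A * m * suc f) ^ m      ≤⟨ ^-monoˡ-≤ m (linear≤exponential (A * m) f f≥) ⟩
  (2 ^ f) ^ m              ≡⟨ ^-*-assoc 2 f m ⟩
  2 ^ (f * m)              ≤⟨ ^-monoʳ-≤ 2 (m/n*n≤m e m) ⟩
  2 ^ e                    ∎
  where
  open ≤-Reasoning
  regroup : ∀ a b c → a * (b * c) ≡ a * c * b
  regroup = solve-∀

-- Choice of the parameters for a given `k`

log : ∀ k .{{_ : NonZero k}} → ∃ λ e → 2 ^ e ≤ k × k < 2 ^ suc e
log (suc zero) = 0 , ≤-refl , ≤-refl
log (suc k@(suc _)) with log k
... | e , lo , hi with suc k <? 2 ^ suc e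
...   | yes lt = e , m≤n⇒m≤1+n lo , lt
...   | no ≮   = suc e , ≮⇒≥ ≮ , ≤-<-trans hi (^-monoʳ-< 2 (s<s z<s) (n<1+n (suc e)))

-- `e` stands for the integer part of the binary logarithm of `k`, and `Q` for the total cost of `r`
-- new colours in `waveFree-power`.
module Parameters (r e : ℕ) where

  ρ L Q : ℕ
  ρ = suc r
  L = 5 * ρ * suc e
  Q = (7 * (ρ * ρ * L)) ^ r

  instance
    Q≢0 : NonZero Q
    Q≢0 = m^n≢0 (7 * (ρ * ρ * L)) r

  -- Exhibits the whole loss as a power of log k; 105 is 3 * 7 * 5, the 3 being drawn into the
  -- power.
  3Q≤ : 3 * Q ≤ (105 * (ρ * ρ * ρ) * suc e) ^ ρ
  3Q≤ = begin
    3 * Q                                  ≤⟨ *-mono-≤ {3} (m≤m*n 3 X) (^-monoˡ-≤ r (m≤n*m X 3)) ⟩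
    (3 * X) * (3 * X) ^ r                  ≡⟨ cong (_^ ρ) (constant ρ (suc e)) ⟩
    (105 * (ρ * ρ * ρ) * suc e) ^ ρ        ∎
    where
    open ≤-Reasoning
    X : ℕ
    X = 7 * (ρ * ρ * L)
    constant : ∀ ρ e → 3 * (7 * (ρ * ρ * (5 * ρ * e))) ≡ 105 * (ρ * ρ * ρ) * e
    constant = solve-∀

good-colouring : ∀ r k e → let open Parameters r e in k < 2 ^ suc e → 3 * Q ≤ k →
                 ∃ λ u → k ≤ 3 * Q * u × WaveFree (suc r) k (u ^ suc (2 * r))
good-colouring r k e k< 3Q≤k = u , k≤ , waveFree-mono Q*v≤k
    (waveFree-power {ρ} {L} (few-for-log ρ e u (<⇒≤ (≤-<-trans u≤k k<))) r ≤-refl)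
  where
  open Parameters r e
  open ≤-Reasoning
  u : ℕ
  -- The largest `u` with `Q * suc u ≤ k`; the rounding is covered by the factor 3 in
  -- `k ≤ 3 * Q * u`.
  u = pred (k ÷ Q)

  3≤v : 3 ≤ k ÷ Q
  3≤v = ≤-trans (≤-reflexive (sym (m*n/n≡m 3 Q))) (/-monoˡ-≤ Q 3Q≤k)

  v : suc u ≡ k ÷ Q
  v = suc-pred (k ÷ Q) {{>-nonZero (≤-trans (s≤s z≤n) 3≤v)}}

  1≤u : 1 ≤ u
  1≤u = s≤s⁻¹ (≤-trans (≤-trans (n≤1+n 2) 3≤v) (≤-reflexive (sym v)))

  instance
    u≢0 : NonZero u
    u≢0 = >-nonZero 1≤u

  Q*v≤k : Q * suc u ≤ k
  Q*v≤k = ≤-trans (≤-reflexive (trans (cong (Q *_) v) (*-comm Q (k ÷ Q)))) (m/n*n≤m k Q)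

  u≤k : u ≤ k
  u≤k = ≤-trans (≤-trans (n≤1+n u) (m≤n*m (suc u) Q)) Q*v≤k

  k≤ : k ≤ 3 * Q * u
  k≤ = begin
    k                    ≤⟨ <⇒≤ (m<[1+m/n]*n k Q) ⟩
    suc (k ÷ Q) * Q      ≡⟨ cong (λ w → suc w * Q) v ⟨
    (2 + u) * Q          ≤⟨ *-monoˡ-≤ Q (+-monoˡ-≤ u (*-monoʳ-≤ 2 1≤u)) ⟩
    (2 * u + u) * Q      ≡⟨ regroup u Q ⟩
    3 * Q * u            ∎
    where
    regroup : ∀ u Q → (2 * u + u) * Q ≡ 3 * Q * u
    regroup = solve-∀

-- From wave-free colourings to lower bounds for `AW`

module FromFin {k M N r : ℕ} (M≤N : M ≤ N) {colour : ℕ → Fin r} {c : Fin r}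
               (p : Fin k → Fin M) (W : IsAscendingWave (λ i → suc (toℕ (p i))))
               (mono : ∀ i → colour (toℕ (p i)) ≡ c) where

  open IsAscendingWave W

  v : ℕ → ℕ
  v i with i <? k
  ... | yes i<k = toℕ (p (fromℕ< i<k))
  ... | no _    = 0

  v-at : ∀ {i} (i<k : i < k) → v i ≡ toℕ (p (fromℕ< i<k))
  v-at {i} i<k with i <? k
  ... | yes _  = refl
  ... | no i≮k = contradiction i<k i≮k

  v<N : ∀ {i} → i < k → v i < N
  v<N i<k = <-≤-trans (subst (_< M) (sym (v-at i<k)) (toℕ<n _)) M≤N

  succ : ∀ {i} (i<k : i < k) (1+i<k : suc i < k) → toℕ (fromℕ< 1+i<k) ≡ suc (toℕ (fromℕ< i<k))
  succ i<k 1+i<k = trans (toℕ-fromℕ< 1+i<k) (cong suc (sym (toℕ-fromℕ< i<k)))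

  v-increasing : ∀ {i} → suc i < k → v i < v (suc i)
  v-increasing 1+i<k = let i<k = <⇒≤ 1+i<k in
    subst₂ _<_ (sym (v-at i<k)) (sym (v-at 1+i<k)) (s≤s⁻¹ (increasing _ _ (succ i<k 1+i<k)))

  -- suc N exceeds every difference inside [0,N), so prolonging by it keeps convexity.
  step : ∀ i → Dec (suc i < k) → ℕ
  step i (yes _) = v (suc i) ∸ v i
  step i (no _)  = suc N

  d : ℕ → ℕ
  d i = step i (suc i <? k)

  step-inside : ∀ {i} → suc i < k → (q : Dec (suc i < k)) → step i q ≡ v (suc i) ∸ v i
  step-inside 1+i<k (yes _) = refl
  step-inside 1+i<k (no ≮)  = contradiction 1+i<k ≮

  step-pos : (q : Dec (1 < k)) → 0 < step 0 q
  step-pos (yes 1<k) = m<n⇒0<n∸m (v-increasing 1<k)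
  step-pos (no _)    = z<s

  step-mono : ∀ i q q′ → step i q ≤ step (suc i) q′
  step-mono i (no ≮)      (yes 2+i<k) = contradiction (<⇒≤ 2+i<k) ≮
  step-mono i (no _)      (no _)      = ≤-refl
  step-mono i (yes 1+i<k) (no _)      = ≤-trans (m∸n≤m _ (v i)) (m≤n⇒m≤1+n (<⇒≤ (v<N 1+i<k)))
  step-mono i (yes 1+i<k) (yes 2+i<k) =
    subst₂ _≤_ (sym (cong₂ _∸_ (v-at 1+i<k) (v-at i<k)))
               (sym (cong₂ _∸_ (v-at 2+i<k) (v-at 1+i<k)))
      (convex _ _ _ (succ i<k 1+i<k) (succ 1+i<k 2+i<k))
    where
    i<k : i < k
    i<k = <⇒≤ 1+i<k

  t : ℕ → ℕ
  t zero    = v 0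
  t (suc i) = t i + d i

  t≡v : ∀ {i} → i < k → t i ≡ v i
  t≡v {zero}  _     = refl
  t≡v {suc i} 1+i<k = trans (cong₂ _+_ (t≡v (<⇒≤ 1+i<k)) (step-inside 1+i<k (suc i <? k)))
                            (m+[n∸m]≡n (<⇒≤ (v-increasing 1+i<k)))

  wave : Wave k (λ x → x < N × colour x ≡ c)
  wave = record
    { term = t ; diff = d ; term-suc = λ _ → refl
    ; diff-pos = step-pos (1 <? k)
    ; diff-suc = λ i → step-mono i (suc i <? k) (suc (suc i) <? k)
    ; satisfies = λ i<k → subst (_< N) (sym (t≡v i<k)) (v<N i<k)
                        , trans (cong colour (trans (t≡v i<k) (v-at i<k))) (mono _) }

-- Otherwise the restriction of the colouring to the first `AW k r` points contains a forced wave,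
-- which `FromFin.wave` prolongs.
waveFree⇒<AW : ∀ {k r N} → WaveFree r k N → N < AW k r
waveFree⇒<AW {k} {r} {N} G = ≰⇒> λ AW≤N →
  let (p , W , c , mono) = IsAW.forces (AW-isAW k r) (λ x → colour (toℕ x))
  in free c (FromFin.wave AW≤N p W mono)
  where open WaveFree G

-- The `b`-th power of the bound k^(c - 1/b) ≤ AW. The factor `k` on the right pays for the loss
-- `(3 * Q) ^ (c * b)`, a power of log k.
AW-lower : ∀ r b .{{_ : NonZero b}} → let c = suc (2 * r) in
           ∃ λ K → 0 < K × ∀ k → K ≤ k → k ^ (c * b) ≤ k * AW k (suc r) ^ b
AW-lower r b = 2 ^ E , m^n>0 2 E , bound
  where
  open ≤-Reasoning
  ρ c A m : ℕ
  ρ = suc r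
  c = suc (2 * r)
  A = 105 * (ρ * ρ * ρ)
  -- The exponent that bounds the loss: `ρ` from `3Q≤`, and `c * b` from the power taken in the
  -- claim.
  m = ρ * (c * b)

  instance
    cb≢0 : NonZero (c * b)
    cb≢0 = m*n≢0 c b

    m≢0 : NonZero m
    m≢0 = m*n≢0 ρ (c * b)

  E : ℕ
  E = proj₁ (polynomial≤exponential A m)

  bound : ∀ k → 2 ^ E ≤ k → k ^ (c * b) ≤ k * AW k ρ ^ b
  bound k K≤k with log k {{>-nonZero (≤-trans (m^n>0 2 E) K≤k)}}
  ... | e , lo , hi = begin
    k ^ (c * b)                     ≤⟨ ^-monoˡ-≤ (c * b) k≤ ⟩
    (3 * Q * u) ^ (c * b)           ≡⟨ ^-distribʳ-* (3 * Q) u (c * b) ⟩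
    (3 * Q) ^ (c * b) * u ^ (c * b) ≡⟨ cong ((3 * Q) ^ (c * b) *_) (^-*-assoc u c b) ⟨
    (3 * Q) ^ (c * b) * (u ^ c) ^ b ≤⟨ *-mono-≤ loss≤k (^-monoˡ-≤ b (<⇒≤ (waveFree⇒<AW G))) ⟩
    k * AW k ρ ^ b                  ∎
    where
    open Parameters r e using (Q; 3Q≤)

    E≤e : E ≤ e
    E≤e = s≤s⁻¹ (≰⇒> λ 1+e≤E → <⇒≱ hi (≤-trans (^-monoʳ-≤ 2 1+e≤E) K≤k))

    loss≤k : (3 * Q) ^ (c * b) ≤ k
    loss≤k = begin
      (3 * Q) ^ (c * b)             ≤⟨ ^-monoˡ-≤ (c * b) 3Q≤ ⟩
      ((A * suc e) ^ ρ) ^ (c * b)   ≡⟨ ^-*-assoc (A * suc e) ρ (c * b) ⟩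
      (A * suc e) ^ m               ≤⟨ proj₂ (polynomial≤exponential A m) e E≤e ⟩
      2 ^ e                         ≤⟨ lo ⟩
      k                             ∎

    3Q≤k : 3 * Q ≤ k
    3Q≤k = ≤-trans (m≤m^n (3 * Q) (c * b)) loss≤k
      where
      m≤m^n : ∀ m n .{{_ : NonZero n}} → m ≤ m ^ n
      m≤m^n zero      n       = z≤n
      m≤m^n m@(suc _) (suc n) = m≤m*n m (m ^ n) {{m^n≢0 m n}}

    colouring : ∃ λ u → k ≤ 3 * Q * u × WaveFree ρ k (u ^ c)
    colouring = good-colouring r k e hi 3Q≤k

    u : ℕ
    u = proj₁ colouring

    k≤ : k ≤ 3 * Q * u
    k≤ = proj₁ (proj₂ colouring)

    G : WaveFree ρ k (u ^ c)
    G = proj₂ (proj₂ colouring)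

-- Rational and real exponents

-- If k ^ (c - 1/b) ≤ y and n/d ≤ c - 1/b then k ^ (n/d) ≤ y.
rational-power : ∀ k y n d c b .{{_ : NonZero k}} .{{_ : NonZero b}} →
                 n * b + d ≤ c * b * d → k ^ (c * b) ≤ k * y ^ b → k ^ n ≤ y ^ d
rational-power k y n d c b exponents bound = ≮⇒≥ λ y^d<k^n →
  <⇒≱ (^-monoˡ-< b y^d<k^n)
    (*-cancelʳ-≤ _ _ (k ^ d) {{m^n≢0 k d}} (begin
      (k ^ n) ^ b * k ^ d         ≡⟨ cong (_* k ^ d) (^-*-assoc k n b) ⟩
      k ^ (n * b) * k ^ d         ≡⟨ ^-distribˡ-+-* k (n * b) d ⟨
      k ^ (n * b + d)             ≤⟨ ^-monoʳ-≤ k exponents ⟩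
      k ^ (c * b * d)             ≡⟨ ^-*-assoc k (c * b) d ⟨
      (k ^ (c * b)) ^ d           ≤⟨ ^-monoˡ-≤ d bound ⟩
      (k * y ^ b) ^ d             ≡⟨ ^-distribʳ-* k (y ^ b) d ⟩
      k ^ d * (y ^ b) ^ d         ≡⟨ *-comm (k ^ d) _ ⟩
      (y ^ b) ^ d * k ^ d         ≡⟨ cong (_* k ^ d) (trans (^-*-assoc y b d)
                                       (trans (cong (y ^_) (*-comm b d)) (sym (^-*-assoc y d b)))) ⟩
      (y ^ d) ^ b * k ^ d         ∎))
  where open ≤-Reasoning

open import Data.Integer.Base as ℤ using (+_; -[1+_])
import Data.Integer.Properties as ℤ
open import Data.Rational.Base as ℚ using (ℚ; mkℚ; 0ℚ; _/_)
import Data.Rational.Properties as ℚ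
open import Data.Rational.Unnormalised.Base as ℚᵘ using (mkℚᵘ; *<*)
import Data.Rational.Unnormalised.Properties as ℚᵘ
open import Algebra.Properties.AbelianGroup ℚ.+-0-abelianGroup using (xyx⁻¹≈y)

-- A positive fraction with denominator b is at least 1/b, so the hypothesis gives n/d + 1/b ≤ c,
-- here with denominators cleared.
exponent-bound : ∀ c n d-1 a b-1 .{h : Coprime (suc a) (suc b-1)} .{h′ : Coprime n (suc d-1)} →
                 mkℚ (+ suc a) b-1 h ℚ.< + c / 1 ℚ.- mkℚ (+ n) d-1 h′ →
                 n * suc b-1 + suc d-1 ≤ c * suc b-1 * suc d-1
exponent-bound c n d-1 a b-1 {h} {h′} δ<c-q = begin
  n * b + d              ≤⟨ +-monoʳ-≤ (n * b) (m≤n*m d (suc a)) ⟩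
  n * b + suc a * d      ≤⟨ <⇒≤ (ℤ.drop‿+<+ integers) ⟩
  c * (d * b)            ≡⟨ trans (cong (c *_) (*-comm d b)) (sym (*-assoc c b d)) ⟩
  c * b * d              ∎
  where
  open ≤-Reasoning
  b d : ℕ
  b = suc b-1
  d = suc d-1

  q δ : ℚ
  q = mkℚ (+ n) d-1 h′
  δ = mkℚ (+ suc a) b-1 h

  q+δ<c : q ℚ.+ δ ℚ.< + c / 1
  q+δ<c = subst (q ℚ.+ δ ℚ.<_)
    (trans (sym (ℚ.+-assoc q (+ c / 1) (ℚ.- q))) (xyx⁻¹≈y q (+ c / 1)))
    (ℚ.+-monoʳ-< q δ<c-q)

  unnormalised : mkℚᵘ (+ n) d-1 ℚᵘ.+ mkℚᵘ (+ suc a) b-1 ℚᵘ.< mkℚᵘ (+ c) 0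
  unnormalised = ℚᵘ.<-respʳ-≃ (ℚ.toℚᵘ-fromℚᵘ (mkℚᵘ (+ c) 0))
    (ℚᵘ.<-respˡ-≃ (ℚ.toℚᵘ-homo-+ q δ) (ℚ.toℚᵘ-mono-< q+δ<c))

  integers : + (n * b + suc a * d) ℤ.< + (c * (d * b))
  integers with unnormalised
  ... | *<* lt = subst₂ ℤ._<_
    (trans (ℤ.*-identityʳ _) (trans (cong₂ ℤ._+_ (sym (ℤ.pos-* n b)) (sym (ℤ.pos-* (suc a) d)))
      (sym (ℤ.pos-+ (n * b) (suc a * d)))))
    (sym (ℤ.pos-* c (d * b))) lt

theorem2 : (r : ℕ) → 1 ≤ r → (ε : ℝ) → 0ℚ <ℝ ε →
    ∃[ K ] ((k : ℕ) → K ≤ k →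
    k ^ℝ (+ (2 * r ∸ 1) / 1 -ℝ ε) ≤ (2 ^ (r ∸ 1) * (40 * r) ^ (r ^ 2 ∸ 1)) * AW k r)
theorem2 (suc r) _ ε ε>0 with lower-open ε ε>0
... | mkℚ (+ zero)  _   _ , ℚ.*<* (ℤ.+<+ ()) , _
-- A rational δ with 0 < δ < ε. Its denominator `b` fixes the exponent loss 1/b ≤ δ, so `K` depends
-- on ε only through `b`.
... | mkℚ (+ suc a) b-1 h , _ , δ<ε = K , bound
  where
  ρ b K C : ℕ
  ρ = suc r
  b = suc b-1
  K = proj₁ (AW-lower r b)
  C = 2 ^ (ρ ∸ 1) * (40 * ρ) ^ (ρ ^ 2 ∸ 1)

  C≢0 : NonZero C
  C≢0 = m*n≢0 (2 ^ r) _ {{m^n≢0 2 r}} {{m^n≢0 (40 * ρ) (ρ ^ 2 ∸ 1)}}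

  exponent : ∀ r → suc (2 * r) ≡ 2 * suc r ∸ 1
  exponent r = sym (+-suc r (r + 0))

  bound : ∀ k → K ≤ k → k ^ℝ (+ (2 * ρ ∸ 1) / 1 -ℝ ε) ≤ C * AW k ρ
  bound k K≤k = below
    where
    instance
      k≢0 : NonZero k
      k≢0 = >-nonZero (≤-trans (proj₁ (proj₂ (AW-lower r b))) K≤k)

    AW≤ : AW k ρ ≤ C * AW k ρ
    AW≤ = m≤n*m (AW k ρ) C {{C≢0}}

    y>0 : 0 < C * AW k ρ
    y>0 = ≤-trans (IsAW.positive (AW-isAW k ρ)) AW≤

    below : ∀ q → ε ℝ< + (2 * ρ ∸ 1) / 1 ℚ.- q → k ^ℚ q ≤ C * AW k ρ
    below (mkℚ (+ n) d-1 h′) ε<c-q =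
      rational-power k (C * AW k ρ) n (suc d-1) (2 * ρ ∸ 1) b
        (exponent-bound (2 * ρ ∸ 1) n d-1 a b-1 (disjoint ε δ<ε ε<c-q))
        (≤-trans (subst (λ c → k ^ (c * b) ≤ k * AW k ρ ^ b) (exponent r)
                   (proj₂ (proj₂ (AW-lower r b)) k K≤k))
          (*-monoʳ-≤ k (^-monoˡ-≤ b AW≤)))
    -- For a negative exponent the claim says that a product of positive powers is at least 1.
    below (mkℚ -[1+ n ] d-1 h′) _ =
      *-mono-≤ (m^n>0 (C * AW k ρ) {{>-nonZero y>0}} (suc d-1)) (m^n>0 k (suc n))
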